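{- Let $F$ be the edge-ordered star forest with five edges in which the first, third and fifth edges (in the edge order) form one star component and the second and fourth edges form another star component. Then $\mathrm{ex}_<(n,F)=\Omega(n\alpha(n))$, where $\alpha$ is the inverse Ackermann function.
   Context: Edge-ordered graph: finite simple graph with a linear order on its edges; isomorphisms preserve order; subgraphs carry induced order; $\mathrm{ex}_<(n,F)$ is the maximum number of edges of an edge-ordered graph on $n$ vertices with no subgraph isomorphic to $F$. -}

module Defs where

open import Data.Nat using (ℕ; zero; suc; _≤?_)
open import Data.Fin using (Fin; _<_; toℕ) renaming (zero to fz; suc to fs)
open import Data.List using (List; []; _∷_; length; lookup)
open import Data.List.Relation.Unary.All using (All)
open import Data.List.Relation.Unary.Unique.Propositional using (Unique)
open import Data.Product using (Σ; _×_; _,_; proj₁; proj₂)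
open import Data.Sum using (_⊎_)
open import Function.Definitions using (Injective)
open import Relation.Binary.PropositionalEquality using (_≡_)
open import Relation.Nullary using (yes; no)

ack : ℕ → ℕ → ℕ
ack zero    n       = suc n
ack (suc k) zero    = ack k 1
ack (suc k) (suc n) = ack k (ack (suc k) n)

-- least k ≥ start with n ≤ ack k k (fuel bounds the search; ack k k ≥ k,
-- so fuel n+1 starting from 0 always suffices)
private
  search : ℕ → ℕ → ℕ → ℕ
  search n k zero = k
  search n k (suc fuel) with n ≤? ack k k
  ... | yes _ = k
  ... | no  _ = search n (suc k) fuel

α : ℕ → ℕ
α n = search n 0 (suc n)

-- Edge-ordered simple graphs on vertex set Fin n.
-- Edges are stored as a list of pairs (u , v) with u < v (no loops,
-- canonical orientation) without repetitions (simple graph);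
-- the linear order on edges is the order of the list (position).

record EOGraph (n : ℕ) : Set where
  field
    edges  : List (Fin n × Fin n)
    normal : All (λ e → proj₁ e < proj₂ e) edges
    simple : Unique edges
open EOGraph public

Joins : ∀ {n} → Fin n × Fin n → Fin n → Fin n → Set
Joins e x y = e ≡ (x , y) ⊎ e ≡ (y , x)

Contains : ∀ {k n} → List (Fin k × Fin k) → EOGraph n → Set
Contains {k} {n} P G =
  Σ (Fin k → Fin n) λ φ → Injective _≡_ _≡_ φ ×
  Σ (Fin (length P) → Fin (length (edges G))) λ σ →
    (∀ i j → i < j → σ i < σ j) ×
    (∀ i → Joins (lookup (edges G) (σ i))
                 (φ (proj₁ (lookup P i))) (φ (proj₂ (lookup P i))))

v : ℕ → Fin 7
v 0 = fz
v 1 = fs fz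
v 2 = fs (fs fz)
v 3 = fs (fs (fs fz))
v 4 = fs (fs (fs (fs fz)))
v 5 = fs (fs (fs (fs (fs fz))))
v _ = fs (fs (fs (fs (fs (fs fz)))))

F : List (Fin 7 × Fin 7)
F = (v 0 , v 1) ∷ (v 4 , v 5) ∷ (v 0 , v 2) ∷ (v 4 , v 6) ∷ (v 0 , v 3) ∷ []

{-# OPTIONS --safe #-}

-- A Davenport–Schinzel type sequence (no subsequence a b a b a with a ≠ b) that is cut into
-- blocks without repeated letters is an edge-ordered graph: the vertices are letters and blocks,
-- the edges are the occurrences, ordered by position.  It avoids F: a star centred at a block is
-- an interval of edges all meeting that block, so no edge disjoint from the block lies between two
-- of its edges; hence both centres are letters a ≠ b, and the edge order spells a b a b a.
--
-- Dense sequences come from a recursion in the style of Hart and Sharir.  Some blocks are live,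
-- all of size m, and each letter has its first occurrence in its only live block.  To compose an
-- outer sequence, whose live blocks have size f, with an inner one having f live blocks, replace
-- each live block B of the outer sequence by a fresh copy of the inner sequence, the j-th letter of
-- B being appended to the j-th live block of the copy, followed by a dead block listing B
-- backwards.  This adds one occurrence to every outer letter.  If a precedes b in a live block, then
-- after that block all a's precede all b's, so a b a…a b…b becomes a b b a a…a b…b and no a b a b a
-- arises between outer letters; an outer letter meets a copy only at its own first occurrence.
--
-- Nesting the composition as in the definition of the Ackermann function gives k + 1 occurrences
-- per letter with fewer dead than live blocks, using a number of letters bounded by the Ackermann
-- function at level k + 3.
module Submission where

open import Defs
open import Data.Fin as Fin using (Fin; #_; zero; suc; toℕ; combine; splitAt; join; inject≤; _↑ˡ_; _↑ʳ_)
import Data.Fin.Properties as Fin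
open import Data.List using (List; []; _∷_; [_]; _++_; map; reverse; length; take; drop; mapMaybe; concatMap; allFin; tabulate; cartesianProduct; lookup)
open import Data.List.Properties using (mapMaybe-++; mapMaybe-map-retract; mapMaybe-map-none; mapMaybeIsInj₁∘mapInj₁; concatMap-++; ++-assoc; ++-identityʳ; reverse-involutive; take++drop≡id; length-++; length-map; length-reverse; length-tabulate; map-++; map-∘; map-id; ∷-injective)
open import Data.List.Membership.Propositional using (_∈_; _∉_)
open import Data.List.Membership.Propositional.Properties using (∈-++⁺ˡ; ∈-++⁺ʳ; ∈-++⁻; ∈-map⁻)
open import Data.List.Relation.Binary.Sublist.Propositional using (_⊆_; []; _∷_; _∷ʳ_; minimum; ⊆-refl; ⊆-reflexive; ⊆-trans; to∈; from∈) renaming (lookup to ⊆-lookup)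
open import Data.List.Relation.Binary.Sublist.Propositional.Properties using (∷ˡ⁻; ++⁺; ++⁺ˡ; ++⁺ʳ; reverse⁺; take-⊆; drop-⊆; drop⁺-≥) renaming (map⁺ to ⊆-map⁺)
open import Data.List.Relation.Unary.All as All using (All; []; _∷_)
import Data.List.Relation.Unary.All.Properties as All
open import Data.List.Relation.Unary.AllPairs as AllPairs using (AllPairs; []; _∷_)
import Data.List.Relation.Unary.AllPairs.Properties as AllPairs
open import Data.List.Relation.Unary.Any using (Any; here; there)
open import Data.List.Relation.Unary.Any.Properties using (reverse⁻)
open import Data.List.Relation.Unary.Unique.Propositional using (Unique)
import Data.List.Relation.Unary.Unique.Propositional.Properties as Unique
open import Data.Maybe using (Maybe; just; nothing)
open import Data.Nat
open import Data.Nat.DivMod using (m≡m%n+[m/n]*n; m%n≤n; m/n*n≤m; m≥n⇒m/n>0)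
open import Data.Nat.Properties
open import Data.Nat.Tactic.RingSolver using (solve-∀)
open import Data.Product using (Σ; ∃; _×_; _,_; proj₁; proj₂; map₂; swap; uncurry)
open import Data.Product.Properties using (,-injectiveˡ; ,-injectiveʳ)
open import Data.Sum as Sum using (_⊎_; inj₁; inj₂; isInj₁)
open import Data.Sum.Properties using (inj₁-injective; inj₂-injective)
open import Data.Unit using (⊤; tt)
open import Function using (_∘_; id)
open import Function.Definitions using (Injective)
open import Relation.Binary.PropositionalEquality using (_≡_; _≢_; refl; sym; trans; cong; cong₂; subst; module ≡-Reasoning)
open import Relation.Nullary using (¬_; yes; no; contradiction)

-- Sublists

private variable
  A S I : Set
  a b x y : A
  p q u t : List A

⊆-++-first : x ∷ p ⊆ u ++ t → x ∈ u ⊎ x ∷ p ⊆ t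
⊆-++-first {u = []} e = inj₂ e
⊆-++-first {u = _ ∷ u} (_ ∷ʳ e) with ⊆-++-first {u = u} e
... | inj₁ x∈u = inj₁ (there x∈u)
... | inj₂ e′ = inj₂ e′
⊆-++-first {u = _ ∷ u} (refl ∷ e) = inj₁ (here refl)

⊆-++-skip : x ∉ u → x ∷ p ⊆ u ++ t → x ∷ p ⊆ t
⊆-++-skip x∉u e with ⊆-++-first e
... | inj₁ x∈u = contradiction x∈u x∉u
... | inj₂ e′ = e′

-- The part of a pattern embedded in `u` is a prefix of it. If `p ++ [ x ]` does not fit there, `x`
-- and everything after it must be found in `t`.
⊆-++-advance : ∀ p u → p ++ x ∷ q ⊆ u ++ t → ¬ (p ++ [ x ] ⊆ u) → x ∷ q ⊆ t
⊆-++-advance p [] e _ = ⊆-trans (++⁺ˡ p ⊆-refl) e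
⊆-++-advance [] (y ∷ u) (_ ∷ʳ e) h = ⊆-++-advance [] u e (h ∘ (y ∷ʳ_))
⊆-++-advance [] (y ∷ u) (refl ∷ e) h = contradiction (refl ∷ minimum u) h
⊆-++-advance (z ∷ p) (y ∷ u) (_ ∷ʳ e) h = ⊆-++-advance (z ∷ p) u e (h ∘ (y ∷ʳ_))
⊆-++-advance (_ ∷ p) (y ∷ u) (refl ∷ e) h = ⊆-++-advance p u e (h ∘ (refl ∷_))

-- The last letter cannot be matched in `t`, so neither can anything before it.
⊆-++-keep : ∀ p u → x ∉ t → p ++ [ x ] ⊆ u ++ t → p ++ [ x ] ⊆ u
⊆-++-keep p [] x∉t e = contradiction (⊆-lookup e (∈-++⁺ʳ p (here refl))) x∉t
⊆-++-keep [] (y ∷ u) x∉t (_ ∷ʳ e) = y ∷ʳ ⊆-++-keep [] u x∉t e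
⊆-++-keep [] (y ∷ u) x∉t (refl ∷ e) = refl ∷ minimum u
⊆-++-keep (z ∷ p) (y ∷ u) x∉t (_ ∷ʳ e) = y ∷ʳ ⊆-++-keep (z ∷ p) u x∉t e
⊆-++-keep (_ ∷ p) (y ∷ u) x∉t (refl ∷ e) = refl ∷ ⊆-++-keep p u x∉t e

mapMaybe⁺ : (f : A → Maybe S) → p ⊆ q → mapMaybe f p ⊆ mapMaybe f q
mapMaybe⁺ f [] = []
mapMaybe⁺ f (y ∷ʳ e) with f y
... | just z = z ∷ʳ mapMaybe⁺ f e
... | nothing = mapMaybe⁺ f e
mapMaybe⁺ f (_∷_ {x} refl e) with f x
... | just z = refl ∷ mapMaybe⁺ f e
... | nothing = mapMaybe⁺ f e

mapMaybe-++⁺ : (f : A → Maybe S) → ∀ u {u′ t′} → mapMaybe f u ⊆ u′ → mapMaybe f t ⊆ t′ → mapMaybe f (u ++ t) ⊆ u′ ++ t′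
mapMaybe-++⁺ f u e e′ = subst (_⊆ _) (sym (mapMaybe-++ f u _)) (++⁺ e e′)

-- Equivalent to `Unique`, but phrased as a forbidden sublist so that it passes along `_⊆_` and
-- `mapMaybe` just as the forbidden alternations do.
NoRepeat : List A → Set
NoRepeat u = ∀ {a} → ¬ (a ∷ a ∷ [] ⊆ u)

NoRepeat-order : NoRepeat u → a ∷ b ∷ [] ⊆ u → ¬ (b ∷ a ∷ [] ⊆ u)
NoRepeat-order h (y ∷ʳ e) (_ ∷ʳ e′) = NoRepeat-order (λ e → h (y ∷ʳ e)) e e′
NoRepeat-order h (y ∷ʳ e) (refl ∷ e′) = h (refl ∷ from∈ (to∈ (∷ˡ⁻ e)))
NoRepeat-order h (refl ∷ e) (_ ∷ʳ e′) = h (refl ∷ from∈ (to∈ (∷ˡ⁻ e′)))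
NoRepeat-order h (refl ∷ e) (refl ∷ e′) = h (refl ∷ e)

reverse-pair : a ∷ b ∷ [] ⊆ reverse u → b ∷ a ∷ [] ⊆ u
reverse-pair {u = u} e = subst (_ ⊆_) (reverse-involutive u) (reverse⁺ e)

NoRepeat-reverse : NoRepeat u → NoRepeat (reverse u)
NoRepeat-reverse nr e = nr (reverse-pair e)

Unique⇒NoRepeat : Unique u → NoRepeat u
Unique⇒NoRepeat (_ ∷ h) (_ ∷ʳ e) = Unique⇒NoRepeat h e
Unique⇒NoRepeat h (refl ∷ e) = Unique.Unique[x∷xs]⇒x∉xs h (to∈ e)

NoRepeat⇒Unique : NoRepeat u → Unique u
NoRepeat⇒Unique {u = []} h = []
NoRepeat⇒Unique {u = x ∷ u} h = All.¬Any⇒All¬ u (λ x∈u → h (refl ∷ from∈ x∈u)) ∷ NoRepeat⇒Unique (λ e → h (x ∷ʳ e))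

∈-order : a ≢ b → a ∈ u → b ∈ u → a ∷ b ∷ [] ⊆ u ⊎ b ∷ a ∷ [] ⊆ u
∈-order a≢b (here refl) (here refl) = contradiction refl a≢b
∈-order a≢b (here refl) (there b∈) = inj₁ (refl ∷ from∈ b∈)
∈-order a≢b (there a∈) (here refl) = inj₂ (refl ∷ from∈ a∈)
∈-order a≢b (there a∈) (there b∈) with ∈-order a≢b a∈ b∈
... | inj₁ e = inj₁ (_ ∷ʳ e)
... | inj₂ e = inj₂ (_ ∷ʳ e)

-- Composition of block sequences

data Block (A : Set) : Set where
  live dead : List A → Block A

Seq : Set → Set
Seq A = List (Block A)

letters liveLetters : Block A → List A
letters (live L) = L
letters (dead L) = L
liveLetters (live L) = L
liveLetters (dead L) = []

flat lives : Seq A → List A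
flat = concatMap letters
lives = concatMap liveLetters

#live #dead : Seq A → ℕ
#live [] = 0
#live (live _ ∷ w) = suc (#live w)
#live (dead _ ∷ w) = #live w
#dead [] = 0
#dead (live _ ∷ w) = #dead w
#dead (dead _ ∷ w) = suc (#dead w)

lives⊆flat : (w : Seq A) → lives w ⊆ flat w
lives⊆flat [] = []
lives⊆flat (live L ∷ w) = ++⁺ ⊆-refl (lives⊆flat w)
lives⊆flat (dead L ∷ w) = ++⁺ˡ L (lives⊆flat w)

-- The second condition puts the first occurrence of every live letter in its live block; the third
-- keeps the block a b … b a that replaces a live a b from creating a b a b a.
data WF {A : Set} : Seq A → Set where
  []   : WF []
  cons : ∀ {B w} → NoRepeat (letters B) → (∀ {a} → a ∈ letters B → a ∉ lives w) →
         (∀ {a b} → a ∷ b ∷ [] ⊆ liveLetters B → ¬ (b ∷ a ∷ [] ⊆ flat w)) →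
         WF w → WF (B ∷ w)

Free : Seq A → Set
Free w = ∀ {a b} → a ≢ b → ¬ (a ∷ b ∷ a ∷ b ∷ a ∷ [] ⊆ flat w)

-- The trace on the outer letters of a composition with outer sequence w.
doubled : Seq A → List A
doubled [] = []
doubled (live L ∷ w) = (L ++ reverse L) ++ doubled w
doubled (dead L ∷ w) = L ++ doubled w

-- Alternations in the outer trace

alternating : A → A → ℕ → List A
alternating a b zero = []
alternating a b (suc n) = a ∷ alternating b a n

Share : A → A → Seq A → Set
Share a b = Any (λ B → a ∈ liveLetters B × b ∈ liveLetters B)

∈-twice : ∀ u → x ∈ u ++ reverse u → x ∈ u
∈-twice u x∈ with ∈-++⁻ u x∈
... | inj₁ x∈u = x∈u
... | inj₂ x∈r = reverse⁻ x∈r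

Share-sym : {w : Seq A} → Share a b w → Share b a w
Share-sym (here h) = here (swap h)
Share-sym (there h) = there (Share-sym h)

-- Both starting letters are needed as hypotheses: each letter matched in `L` exchanges the roles of
-- `a` and `b`.
alternating-++ : ∀ L → (∀ n → alternating a b n ⊆ u → alternating a b n ⊆ t) →
                 (∀ n → alternating b a n ⊆ u → alternating b a n ⊆ t) →
                 ∀ n → alternating a b n ⊆ L ++ u → alternating a b n ⊆ L ++ t
alternating-++ [] f g n e = f n e
alternating-++ (x ∷ L) f g zero e = minimum _
alternating-++ (x ∷ L) f g (suc n) (_ ∷ʳ e) = x ∷ʳ alternating-++ L f g (suc n) e
alternating-++ (x ∷ L) f g (suc n) (refl ∷ e) = refl ∷ alternating-++ L g f n e

-- A live block contains at most one of the two letters, so `L ++ reverse L` matches at most one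
-- term of the alternation, and `L` alone can already supply that term.
doubled⇒flat : (w : Seq A) → ¬ Share a b w → ∀ n → alternating a b n ⊆ doubled w → alternating a b n ⊆ flat w
doubled⇒flat [] h n e = e
doubled⇒flat (dead L ∷ w) h n e =
  alternating-++ L (doubled⇒flat w (h ∘ there)) (doubled⇒flat w (h ∘ there ∘ Share-sym)) n e
doubled⇒flat (live L ∷ w) h zero e = minimum _
doubled⇒flat {a = a} {b} (live L ∷ w) h (suc n) e with ⊆-++-first e
... | inj₂ e′ = ++⁺ˡ L (doubled⇒flat w (h ∘ there) (suc n) e′)
... | inj₁ a∈ = ++⁺ (from∈ a∈L) (doubled⇒flat w (h ∘ there ∘ Share-sym) n (rest n e))
  where
  a∈L : a ∈ L
  a∈L = ∈-twice L a∈
  rest : ∀ n → a ∷ alternating b a n ⊆ (L ++ reverse L) ++ doubled w → alternating b a n ⊆ doubled w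
  rest zero _ = minimum _
  rest (suc n) e = ⊆-++-advance [ a ] (L ++ reverse L) e
    λ ab → h (here (a∈L , ∈-twice L (⊆-lookup ab (there (here refl)))))

Share⇒∈lives : {w : Seq A} → Share a b w → a ∈ lives w
Share⇒∈lives (here (a∈ , _)) = ∈-++⁺ˡ a∈
Share⇒∈lives {w = B ∷ w} (there h) = ∈-++⁺ʳ (liveLetters B) (Share⇒∈lives h)

-- Nothing before the shared live block contains `a`, so the pattern starts there. As `L` and
-- `reverse L` list the two letters in opposite orders, together they match at most three terms if
-- `a` comes first in `L`, and at most two otherwise. What remains violates the order condition of
-- `WF` for the rest of the sequence, where the letters share no live block.
Share-Free : {w : Seq A} → WF w → Share a b w → a ≢ b → ¬ (a ∷ b ∷ a ∷ b ∷ a ∷ [] ⊆ doubled w)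
Share-Free {w = dead L ∷ w} (cons _ fresh _ wf) (there h) a≢b e =
  Share-Free wf h a≢b (⊆-++-skip (λ a∈ → fresh a∈ (Share⇒∈lives h)) e)
Share-Free {w = live L ∷ w} (cons _ fresh _ wf) (there h) a≢b e =
  Share-Free wf h a≢b (⊆-++-skip (λ a∈ → fresh (∈-twice L a∈) (Share⇒∈lives h)) e)
Share-Free {a = a} {b} {w = live L ∷ w} (cons nr fresh ord wf) (here (a∈ , b∈)) a≢b e
  with ∈-order a≢b a∈ b∈ | subst (_ ⊆_) (++-assoc L (reverse L) (doubled w)) e
... | inj₁ ab | e₁ = ord ab (doubled⇒flat w (fresh b∈ ∘ Share⇒∈lives) 2 e₃)
  where
  e₂ : a ∷ b ∷ a ∷ [] ⊆ reverse L ++ doubled w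
  e₂ = ⊆-++-advance (a ∷ b ∷ []) L e₁ λ aba → NoRepeat-order nr ab (∷ˡ⁻ aba)
  e₃ : b ∷ a ∷ [] ⊆ doubled w
  e₃ = ⊆-++-advance [ a ] (reverse L) e₂ λ ab′ → NoRepeat-order nr ab (reverse-pair ab′)
... | inj₂ ba | e₁ = ord ba (doubled⇒flat w (fresh a∈ ∘ Share⇒∈lives) 2 (⊆-trans (refl ∷ refl ∷ _ ∷ʳ []) e₃))
  where
  e₂ : b ∷ a ∷ b ∷ a ∷ [] ⊆ reverse L ++ doubled w
  e₂ = ⊆-++-advance [ a ] L e₁ λ ab → NoRepeat-order nr ba ab
  e₃ : a ∷ b ∷ a ∷ [] ⊆ doubled w
  e₃ = ⊆-++-advance [ b ] (reverse L) e₂ λ ba′ → NoRepeat-order nr ba (reverse-pair ba′)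

doubled-Free : {w : Seq A} → WF w → Free w → a ≢ b → ¬ (a ∷ b ∷ a ∷ b ∷ a ∷ [] ⊆ doubled w)
-- Sharing a live block is refuted by `Share-Free`, so `Share` need not be decided.
doubled-Free {w = w} wf free a≢b e = free a≢b (doubled⇒flat w (λ h → Share-Free wf h a≢b e) 5 e)

-- Interleaving outer and inner letters

tag : I → S → A ⊎ (I × S)
tag i x = inj₂ (i , x)

inner : A ⊎ (I × S) → Maybe S
inner (inj₁ _) = nothing
inner (inj₂ (_ , x)) = just x

mixed : I → List S → List A → List (A ⊎ (I × S))
mixed i L T = map (tag i) L ++ map inj₁ T

-- Meant for length B ≡ #live s: surplus letters of B are dropped.
shuffle : I → List A → Seq S → Seq (A ⊎ (I × S))
shuffle i B [] = []
shuffle i B (dead L ∷ s) = dead (mixed i L []) ∷ shuffle i B s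
shuffle i B (live L ∷ s) = live (mixed i L (take 1 B)) ∷ shuffle i (drop 1 B) s

-- The index map `ι` names the copies; it is a parameter so that the recursion past a live block can
-- pass to `ι ∘ suc`.
compose : (w : Seq A) → (Fin (#live w) → I) → Seq S → Seq (A ⊎ (I × S))
compose [] ι s = []
compose (dead L ∷ w) ι s = dead (map inj₁ L) ∷ compose w ι s
compose (live B ∷ w) ι s =
  shuffle (ι zero) B s ++ dead (map inj₁ (reverse B)) ∷ compose w (ι ∘ suc) s

mapMaybe-∈ : (f : A → Maybe S) → f x ≡ just y → x ∈ u → y ∈ mapMaybe f u
mapMaybe-∈ {x = x} f eq x∈ with f x | mapMaybe⁺ f (from∈ x∈)
mapMaybe-∈ f refl x∈ | just _ | e = to∈ e

inner-mixed : ∀ (i : I) (L : List S) (T : List A) → mapMaybe inner (mixed i L T) ≡ L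
inner-mixed i L T = begin
  mapMaybe inner (mixed i L T)
    ≡⟨ mapMaybe-++ inner (map (tag i) L) (map inj₁ T) ⟩
  mapMaybe inner (map (tag i) L) ++ mapMaybe inner (map inj₁ T)
    ≡⟨ cong₂ _++_ (mapMaybe-map-retract (λ _ → refl) L) (mapMaybe-map-none (λ _ → refl) T) ⟩
  L ++ []
    ≡⟨ ++-identityʳ L ⟩
  L ∎
  where open ≡-Reasoning

outer-mixed : ∀ (i : I) (L : List S) (T : List A) → mapMaybe isInj₁ (mixed i L T) ≡ T
outer-mixed i L T = trans (mapMaybe-++ isInj₁ (map (tag i) L) (map inj₁ T))
  (cong₂ _++_ (mapMaybe-map-none (λ _ → refl) L) (mapMaybe-map-retract (λ _ → refl) T))

tag-mixed : ∀ {i j : I} {L : List S} {T : List A} → inj₂ (j , x) ∈ mixed i L T → j ≡ i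
tag-mixed {i = i} {L = L} h with ∈-++⁻ (map (tag i) L) h
... | inj₁ h′ with _ , _ , refl ← ∈-map⁻ (tag i) h′ = refl
... | inj₂ h′ with _ , _ , () ← ∈-map⁻ inj₁ h′

shuffle-inner : ∀ (i : I) (B : List A) (s : Seq S) → mapMaybe inner (flat (shuffle i B s)) ≡ flat s
shuffle-inner i B [] = refl
shuffle-inner i B (dead L ∷ s) = trans (mapMaybe-++ inner (mixed i L []) _)
  (cong₂ _++_ (inner-mixed i L []) (shuffle-inner i B s))
shuffle-inner i B (live L ∷ s) = trans (mapMaybe-++ inner (mixed i L (take 1 B)) _)
  (cong₂ _++_ (inner-mixed i L (take 1 B)) (shuffle-inner i (drop 1 B) s))

shuffle-inner-lives : ∀ (i : I) (B : List A) (s : Seq S) → mapMaybe inner (lives (shuffle i B s)) ≡ lives s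
shuffle-inner-lives i B [] = refl
shuffle-inner-lives i B (dead L ∷ s) = shuffle-inner-lives i B s
shuffle-inner-lives i B (live L ∷ s) = trans (mapMaybe-++ inner (mixed i L (take 1 B)) _)
  (cong₂ _++_ (inner-mixed i L (take 1 B)) (shuffle-inner-lives i (drop 1 B) s))

-- Only a sublist, since surplus letters of `B` are lost; excluding patterns needs no more than this
-- direction.
shuffle-outer : ∀ (i : I) (B : List A) (s : Seq S) → mapMaybe isInj₁ (flat (shuffle i B s)) ⊆ B
shuffle-outer i B [] = minimum B
shuffle-outer i B (dead L ∷ s) =
  mapMaybe-++⁺ isInj₁ (mixed i L []) (⊆-reflexive (outer-mixed i L [])) (shuffle-outer i B s)
shuffle-outer i B (live L ∷ s) = ⊆-trans
  (mapMaybe-++⁺ isInj₁ (mixed i L (take 1 B)) (⊆-reflexive (outer-mixed i L (take 1 B))) (shuffle-outer i (drop 1 B) s))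
  (⊆-reflexive (take++drop≡id 1 B))

shuffle-tag : ∀ {i j : I} {B : List A} (s : Seq S) → inj₂ (j , x) ∈ flat (shuffle i B s) → j ≡ i
shuffle-tag {i = i} {B = B} (dead L ∷ s) h with ∈-++⁻ (mixed i L []) h
... | inj₁ h′ = tag-mixed {L = L} {[]} h′
... | inj₂ h′ = shuffle-tag s h′
shuffle-tag {i = i} {B = B} (live L ∷ s) h with ∈-++⁻ (mixed i L (take 1 B)) h
... | inj₁ h′ = tag-mixed {L = L} {take 1 B} h′
... | inj₂ h′ = shuffle-tag s h′

shuffle-∈ : ∀ {i : I} {B : List A} (s : Seq S) → inj₁ a ∈ flat (shuffle i B s) → a ∈ B
shuffle-∈ s h = ⊆-lookup (shuffle-outer _ _ s) (mapMaybe-∈ isInj₁ refl h)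

take-drop : NoRepeat u → x ∈ take 1 u → x ∉ drop 1 u
take-drop {u = _ ∷ _} nr (here refl) h = nr (refl ∷ from∈ h)

take-one : ∀ (u : List A) → ¬ (x ∷ y ∷ [] ⊆ take 1 u)
take-one (_ ∷ u) (_ ∷ʳ ())
take-one (_ ∷ u) (_ ∷ ())

mixed-NoRepeat : ∀ (i : I) (L : List S) {T : List A} → NoRepeat L → NoRepeat T → NoRepeat (mixed i L T)
mixed-NoRepeat i L {T} nrL nrT {inj₁ _} e = nrT (subst (_ ⊆_) (outer-mixed i L T) (mapMaybe⁺ isInj₁ e))
mixed-NoRepeat i L {T} nrL nrT {inj₂ _} e = nrL (subst (_ ⊆_) (inner-mixed i L T) (mapMaybe⁺ inner e))

-- Well-formedness of compositions

module _ {r : Seq (A ⊎ (I × S))} {i : I} (r-tag : ∀ {x} → inj₂ (i , x) ∉ flat r) where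

  fresh-mixed : ∀ {B : List A} {s : Seq S} L {T} →
                (∀ {a} → a ∈ T → a ∉ B) → (∀ {a} → a ∈ T → inj₁ a ∉ lives r) → (∀ {x} → x ∈ L → x ∉ lives s) →
                ∀ {z} → z ∈ mixed i L T → z ∉ lives (shuffle i B s ++ r)
  fresh-mixed {B} {s} L {T} T∉B T∉r L∉s {z} z∈ z∈′
    rewrite concatMap-++ liveLetters (shuffle i B s) r with ∈-++⁻ (lives (shuffle i B s)) z∈′
  fresh-mixed {B} {s} L {T} T∉B T∉r L∉s {inj₁ a} z∈ _ | inj₁ h =
    T∉B (subst (a ∈_) (outer-mixed i L T) (mapMaybe-∈ isInj₁ refl z∈))
        (shuffle-∈ s (⊆-lookup (lives⊆flat (shuffle i B s)) h))
  fresh-mixed {B} {s} L {T} T∉B T∉r L∉s {inj₁ a} z∈ _ | inj₂ h =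
    T∉r (subst (a ∈_) (outer-mixed i L T) (mapMaybe-∈ isInj₁ refl z∈)) h
  fresh-mixed {B} {s} L {T} T∉B T∉r L∉s {inj₂ (j , x)} z∈ _ | inj₁ h =
    L∉s (subst (x ∈_) (inner-mixed i L T) (mapMaybe-∈ inner refl z∈))
        (subst (x ∈_) (shuffle-inner-lives i B s) (mapMaybe-∈ inner refl h))
  fresh-mixed {B} {s} L {T} T∉B T∉r L∉s {inj₂ (j , x)} z∈ _ | inj₂ h with refl ← tag-mixed {L = L} {T} z∈ =
    r-tag (⊆-lookup (lives⊆flat r) h)

  -- A live block holds at most one outer letter, in last place. So the pair is either inner, where
  -- the condition comes from `s`, or ends with the outer letter. In the latter case the reversed
  -- pair would put that letter before a letter of copy `i`, hence again inside the same copy,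
  -- although `B` lists it once.
  order-mixed : ∀ {B : List A} {s : Seq S} {L} → NoRepeat B →
                (∀ {x y} → x ∷ y ∷ [] ⊆ L → ¬ (y ∷ x ∷ [] ⊆ flat s)) →
                ∀ {x y} → x ∷ y ∷ [] ⊆ mixed i L (take 1 B) → ¬ (y ∷ x ∷ [] ⊆ flat (shuffle i (drop 1 B) s ++ r))
  order-mixed {B} {s} {L} nr ord {x} {y} e e′ rewrite concatMap-++ letters (shuffle i (drop 1 B) s) r = go e e′
    where
    go : ∀ {x y} → x ∷ y ∷ [] ⊆ mixed i L (take 1 B) → ¬ (y ∷ x ∷ [] ⊆ flat (shuffle i (drop 1 B) s) ++ flat r)
    go {inj₁ _} {inj₁ _} e _ = take-one B (subst (_ ⊆_) (outer-mixed i L (take 1 B)) (mapMaybe⁺ isInj₁ e))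
    go {inj₁ a} {inj₂ _} e _ with ⊆-++-skip {u = map (tag i) L} (λ h → case-tag (∈-map⁻ (tag i) h)) e
      where
      case-tag : ¬ ∃ λ y → y ∈ L × inj₁ a ≡ tag i y
      case-tag ()
    ... | e₁ with _ , _ , () ← ∈-map⁻ inj₁ (⊆-lookup e₁ (there (here refl)))
    go {inj₂ _} {inj₁ a} e e′ with refl ← tag-mixed {L = L} {take 1 B} (⊆-lookup e (here refl)) =
      take-drop nr (subst (a ∈_) (outer-mixed i L (take 1 B)) (mapMaybe-∈ isInj₁ refl (⊆-lookup e (there (here refl)))))
        (shuffle-∈ s (⊆-lookup (⊆-++-keep [ _ ] _ r-tag e′) (here refl)))
    go {inj₂ _} {inj₂ _} e e′ with refl ← tag-mixed {L = L} {take 1 B} (⊆-lookup e (here refl)) =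
      ord (subst (_ ⊆_) (inner-mixed i L (take 1 B)) (mapMaybe⁺ inner e))
          (subst (_ ⊆_) (shuffle-inner i (drop 1 B) s) (mapMaybe⁺ inner (⊆-++-keep [ _ ] _ r-tag e′)))

  shuffle-WF : ∀ {B : List A} {s : Seq S} → NoRepeat B → (∀ {a} → a ∈ B → inj₁ a ∉ lives r) →
               WF s → WF r → WF (shuffle i B s ++ r)
  shuffle-WF {s = []} nr B∉r wf-s wf-r = wf-r
  shuffle-WF {B} {dead L ∷ s} nr B∉r (cons nrL fresh ord wf-s) wf-r =
    cons (mixed-NoRepeat i L nrL λ ()) (fresh-mixed {s = s} L {[]} (λ ()) (λ ()) fresh) (λ ())
         (shuffle-WF nr B∉r wf-s wf-r)
  shuffle-WF {B} {live L ∷ s} nr B∉r (cons nrL fresh ord wf-s) wf-r =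
    cons (mixed-NoRepeat i L nrL λ e → take-one B e)
         (fresh-mixed {s = s} L (take-drop nr) (λ h → B∉r (⊆-lookup (take-⊆ 1 B) h)) fresh)
         (order-mixed {s = s} nr ord)
         (shuffle-WF (λ e → nr (⊆-trans e (drop-⊆ 1 B))) (λ h → B∉r (⊆-lookup (drop-⊆ 1 B) h)) wf-s wf-r)

∉-inj₁ : {L : List A} {z : S} → inj₂ z ∉ map inj₁ L
∉-inj₁ h with _ , _ , () ← ∈-map⁻ inj₁ h

∈-inj₁ : {L : List A} → inj₁ {B = S} a ∈ map inj₁ L → a ∈ L
∈-inj₁ h with _ , a∈ , refl ← ∈-map⁻ inj₁ h = a∈

inj₁-NoRepeat : {L : List A} → NoRepeat L → NoRepeat (map (inj₁ {B = S}) L)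
inj₁-NoRepeat nr = Unique⇒NoRepeat (Unique.map⁺ (λ { refl → refl }) (NoRepeat⇒Unique nr))

compose-live : ∀ (B : List A) (w : Seq A) (ι : Fin (suc (#live w)) → I) (s : Seq S) →
               flat (compose (live B ∷ w) ι s) ≡
               flat (shuffle (ι zero) B s) ++ map inj₁ (reverse B) ++ flat (compose w (ι ∘ suc) s)
compose-live B w ι s = concatMap-++ letters (shuffle (ι zero) B s) _

compose-tag : ∀ (w : Seq A) (ι : Fin (#live w) → I) (s : Seq S) {j x} →
              inj₂ (j , x) ∈ flat (compose w ι s) → ∃ λ k → j ≡ ι k
compose-tag (dead L ∷ w) ι s h with ∈-++⁻ (map inj₁ L) h
... | inj₁ h′ = contradiction h′ ∉-inj₁
... | inj₂ h′ = compose-tag w ι s h′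
compose-tag (live B ∷ w) ι s h rewrite compose-live B w ι s with ∈-++⁻ (flat (shuffle (ι zero) B s)) h
... | inj₁ h′ = zero , shuffle-tag s h′
... | inj₂ h′ with ∈-++⁻ (map inj₁ (reverse B)) h′
...   | inj₁ h″ = contradiction h″ ∉-inj₁
...   | inj₂ h″ with k , eq ← compose-tag w (ι ∘ suc) s h″ = suc k , eq

compose-lives : ∀ (w : Seq A) (ι : Fin (#live w) → I) (s : Seq S) → inj₁ a ∈ lives (compose w ι s) → a ∈ lives w
compose-lives (dead L ∷ w) ι s h = compose-lives w ι s h
compose-lives (live B ∷ w) ι s h
  rewrite concatMap-++ liveLetters (shuffle (ι zero) B s) (dead (map inj₁ (reverse B)) ∷ compose w (ι ∘ suc) s)
  with ∈-++⁻ (lives (shuffle (ι zero) B s)) h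
... | inj₁ h′ = ∈-++⁺ˡ (shuffle-∈ s (⊆-lookup (lives⊆flat (shuffle (ι zero) B s)) h′))
... | inj₂ h′ = ∈-++⁺ʳ B (compose-lives w (ι ∘ suc) s h′)

tag-fresh : ∀ {B : List A} (w : Seq A) (ι : Fin (suc (#live w)) → I) (s : Seq S) → Injective _≡_ _≡_ ι →
            ∀ {x} → inj₂ (ι zero , x) ∉ map inj₁ (reverse B) ++ flat (compose w (ι ∘ suc) s)
tag-fresh {B = B} w ι s inj h with ∈-++⁻ (map inj₁ (reverse B)) h
... | inj₁ h′ = ∉-inj₁ h′
... | inj₂ h′ with _ , eq ← compose-tag w (ι ∘ suc) s h′ = Fin.0≢1+n (inj eq)

compose-WF : ∀ (w : Seq A) (ι : Fin (#live w) → I) {s : Seq S} → Injective _≡_ _≡_ ι → WF w → WF s → WF (compose w ι s)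
compose-WF [] ι inj wf wf-s = []
compose-WF (dead L ∷ w) ι {s} inj (cons nr fresh _ wf) wf-s =
  cons (inj₁-NoRepeat nr) fresh′ (λ ()) (compose-WF w ι inj wf wf-s)
  where
  fresh′ : ∀ {z} → z ∈ map inj₁ L → z ∉ lives (compose w ι s)
  fresh′ {inj₁ _} h h′ = fresh (∈-inj₁ h) (compose-lives w ι s h′)
  fresh′ {inj₂ _} h _ = ∉-inj₁ h
compose-WF (live B ∷ w) ι {s} inj (cons nr fresh _ wf) wf-s =
  shuffle-WF (tag-fresh {B = B} w ι s inj) nr (λ h h′ → fresh h (compose-lives w (ι ∘ suc) s h′)) wf-s
    (cons (inj₁-NoRepeat (NoRepeat-reverse nr)) fresh′ (λ ()) (compose-WF w (ι ∘ suc) (Fin.suc-injective ∘ inj) wf wf-s))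
  where
  fresh′ : ∀ {z} → z ∈ map inj₁ (reverse B) → z ∉ lives (compose w (ι ∘ suc) s)
  fresh′ {inj₁ _} h h′ = fresh (reverse⁻ (∈-inj₁ h)) (compose-lives w (ι ∘ suc) s h′)
  fresh′ {inj₂ _} h _ = ∉-inj₁ h

-- Exclusion of a b a b a from compositions

compose-outer : ∀ (w : Seq A) (ι : Fin (#live w) → I) (s : Seq S) → mapMaybe isInj₁ (flat (compose w ι s)) ⊆ doubled w
compose-outer [] ι s = []
compose-outer (dead L ∷ w) ι s =
  mapMaybe-++⁺ isInj₁ (map inj₁ L) (⊆-reflexive (mapMaybeIsInj₁∘mapInj₁ L)) (compose-outer w ι s)
compose-outer (live B ∷ w) ι s rewrite compose-live B w ι s | ++-assoc B (reverse B) (doubled w) =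
  mapMaybe-++⁺ isInj₁ (flat (shuffle (ι zero) B s)) (shuffle-outer (ι zero) B s)
    (mapMaybe-++⁺ isInj₁ (map inj₁ (reverse B)) (⊆-reflexive (mapMaybeIsInj₁∘mapInj₁ (reverse B)))
      (compose-outer w (ι ∘ suc) s))

-- Since `ι` is injective, the letters of copy `i` occur in a single shuffle, and so does everything
-- between two of them.
compose-between : ∀ (w : Seq A) (ι : Fin (#live w) → I) (s : Seq S) → Injective _≡_ _≡_ ι → ∀ {i x y} p →
  let q = inj₂ (i , x) ∷ p ++ [ inj₂ (i , y) ] in
  q ⊆ flat (compose w ι s) → ∃ λ B → (∀ {a} → a ∈ B → a ∈ lives w) × q ⊆ flat (shuffle i B s)
compose-between (dead L ∷ w) ι s inj p e = compose-between w ι s inj p (⊆-++-skip ∉-inj₁ e)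
compose-between (live B ∷ w) ι s inj p e rewrite compose-live B w ι s
  with ⊆-++-first {u = flat (shuffle (ι zero) B s)} e
... | inj₁ h with refl ← shuffle-tag s h = B , ∈-++⁺ˡ , ⊆-++-keep (_ ∷ p) _ (tag-fresh {B = B} w ι s inj) e
... | inj₂ e′ with B′ , B′⊆ , e″ ← compose-between w (ι ∘ suc) s (Fin.suc-injective ∘ inj) p (⊆-++-skip ∉-inj₁ e′) =
  B′ , ∈-++⁺ʳ B ∘ B′⊆ , e″

between-∈ : ∀ (w : Seq A) (ι : Fin (#live w) → I) (s : Seq S) → Injective _≡_ _≡_ ι → ∀ {i x} →
            inj₂ (i , x) ∷ inj₁ a ∷ inj₂ (i , x) ∷ [] ⊆ flat (compose w ι s) → a ∈ lives w
between-∈ w ι s inj e with B , B⊆ , e′ ← compose-between w ι s inj [ _ ] e =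
  B⊆ (shuffle-∈ s (⊆-lookup e′ (there (here refl))))

-- An outer letter between two letters of a copy is at its first occurrence.  This excludes both
-- a b a b a and b a b a b for a outer and b inner.
outer-inner : ∀ (w : Seq A) (ι : Fin (#live w) → I) (s : Seq S) → Injective _≡_ _≡_ ι → WF w → ∀ {b} →
              ¬ (inj₁ a ∷ inj₂ b ∷ inj₁ a ∷ inj₂ b ∷ [] ⊆ flat (compose w ι s))
outer-inner (dead L ∷ w) ι s inj (cons _ fresh _ wf) e with ⊆-++-first e
... | inj₁ h = fresh (∈-inj₁ h) (between-∈ w ι s inj (⊆-++-skip ∉-inj₁ (∷ˡ⁻ e)))
... | inj₂ e′ = outer-inner w ι s inj wf e′
outer-inner {a = a} (live B ∷ w) ι s inj (cons nr fresh _ wf) {b} e =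
  go (subst (_ ⊆_) (compose-live B w ι s) e)
  where
  shuf = flat (shuffle (ι zero) B s)
  rest = map inj₁ (reverse B) ++ flat (compose w (ι ∘ suc) s)

  later : a ∈ B → ¬ (inj₂ b ∷ inj₁ a ∷ inj₂ b ∷ [] ⊆ rest)
  later a∈ e = fresh a∈ (between-∈ w (ι ∘ suc) s (Fin.suc-injective ∘ inj) (⊆-++-skip ∉-inj₁ e))

  go : ¬ (inj₁ a ∷ inj₂ b ∷ inj₁ a ∷ inj₂ b ∷ [] ⊆ shuf ++ rest)
  go e with ⊆-++-first {u = shuf} e
  go e | inj₁ h with ⊆-++-first {u = shuf} (∷ˡ⁻ e)
  ... | inj₂ e′ = later (shuffle-∈ s h) e′
  -- Here `b` belongs to the present copy, so the whole pattern lies in `shuf`, whose outer trace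
  -- would contain `a` twice although it is a sublist of `B`.
  ... | inj₁ h′ with refl ← shuffle-tag s h′ =
    nr (⊆-trans (mapMaybe⁺ isInj₁ (⊆-++-keep (inj₁ a ∷ inj₂ b ∷ inj₁ a ∷ []) shuf (tag-fresh {B = B} w ι s inj) e))
                (shuffle-outer (ι zero) B s))
  go e | inj₂ e′ with ⊆-++-first {u = map inj₁ (reverse B)} e′
  ... | inj₁ h = later (reverse⁻ (∈-inj₁ h)) (∷ˡ⁻ e′)
  ... | inj₂ e″ = outer-inner w (ι ∘ suc) s (Fin.suc-injective ∘ inj) wf e″

compose-Free : ∀ (w : Seq A) (ι : Fin (#live w) → I) (s : Seq S) → Injective _≡_ _≡_ ι →
               WF w → Free w → Free s → Free (compose w ι s)
compose-Free w ι s inj wf free free-s {inj₁ _} {inj₁ _} a≢b e =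
  doubled-Free wf free (a≢b ∘ cong inj₁) (⊆-trans (mapMaybe⁺ isInj₁ e) (compose-outer w ι s))
compose-Free w ι s inj wf free free-s {inj₁ _} {inj₂ _} a≢b e =
  outer-inner w ι s inj wf (⊆-trans (refl ∷ refl ∷ refl ∷ refl ∷ _ ∷ʳ []) e)
compose-Free w ι s inj wf free free-s {inj₂ _} {inj₁ _} a≢b e = outer-inner w ι s inj wf (∷ˡ⁻ e)
-- The pattern starts and ends in copy `i`, so it lies in one shuffle. Hence `j` equals `i`, and
-- erasing the indices keeps the two letters distinct.
compose-Free w ι s inj wf free free-s {inj₂ (i , x)} {inj₂ (j , y)} a≢b e
  with B , _ , e′ ← compose-between w ι s inj (_ ∷ _ ∷ _ ∷ []) e
  with refl ← shuffle-tag s (⊆-lookup e′ (there (here refl))) =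
  free-s (a≢b ∘ cong (tag i)) (subst (_ ⊆_) (shuffle-inner i B s) (mapMaybe⁺ inner e′))

-- Counting

LiveSize : ℕ → Block A → Set
LiveSize m (live L) = length L ≡ m
LiveSize m (dead _) = ⊤

#live-++ : (w w′ : Seq A) → #live (w ++ w′) ≡ #live w + #live w′
#live-++ [] w′ = refl
#live-++ (live _ ∷ w) w′ = cong suc (#live-++ w w′)
#live-++ (dead _ ∷ w) w′ = #live-++ w w′

#dead-++ : (w w′ : Seq A) → #dead (w ++ w′) ≡ #dead w + #dead w′
#dead-++ [] w′ = refl
#dead-++ (live _ ∷ w) w′ = #dead-++ w w′
#dead-++ (dead _ ∷ w) w′ = cong suc (#dead-++ w w′)

length-blocks : (w : Seq A) → length w ≡ #live w + #dead w
length-blocks [] = refl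
length-blocks (live _ ∷ w) = cong suc (length-blocks w)
length-blocks (dead _ ∷ w) = trans (cong suc (length-blocks w)) (sym (+-suc (#live w) (#dead w)))

#live-shuffle : ∀ (i : I) (B : List A) (s : Seq S) → #live (shuffle i B s) ≡ #live s
#live-shuffle i B [] = refl
#live-shuffle i B (live L ∷ s) = cong suc (#live-shuffle i (drop 1 B) s)
#live-shuffle i B (dead L ∷ s) = #live-shuffle i B s

#dead-shuffle : ∀ (i : I) (B : List A) (s : Seq S) → #dead (shuffle i B s) ≡ #dead s
#dead-shuffle i B [] = refl
#dead-shuffle i B (live L ∷ s) = #dead-shuffle i (drop 1 B) s
#dead-shuffle i B (dead L ∷ s) = cong suc (#dead-shuffle i B s)

length-mixed : ∀ (i : I) (L : List S) (T : List A) → length (mixed i L T) ≡ length T + length L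
length-mixed i L T = begin
  length (mixed i L T)                          ≡⟨ length-++ (map (tag i) L) ⟩
  length (map (tag i) L) + length (map inj₁ T)  ≡⟨ cong₂ _+_ (length-map (tag i) L) (length-map inj₁ T) ⟩
  length L + length T                           ≡⟨ +-comm (length L) (length T) ⟩
  length T + length L                           ∎
  where open ≡-Reasoning

length-shuffle : ∀ (i : I) (B : List A) (s : Seq S) → length B ≡ #live s →
                 length (flat (shuffle i B s)) ≡ length B + length (flat s)
length-shuffle i [] [] eq = refl
length-shuffle {A = A} i B (dead L ∷ s) eq = begin
  length (mixed {A = A} i L [] ++ flat (shuffle i B s))
    ≡⟨ length-++ (mixed i L []) ⟩
  length (mixed {A = A} i L []) + length (flat (shuffle i B s))
    ≡⟨ cong₂ _+_ (length-mixed {A = A} i L []) (length-shuffle i B s eq) ⟩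
  length L + (length B + length (flat s))
    ≡⟨ lemma (length L) (length B) (length (flat s)) ⟩
  length B + (length L + length (flat s))
    ≡⟨ cong (length B +_) (length-++ L) ⟨
  length B + length (L ++ flat s) ∎
  where
  open ≡-Reasoning
  lemma : ∀ x y z → x + (y + z) ≡ y + (x + z)
  lemma = solve-∀
length-shuffle i (b ∷ B) (live L ∷ s) eq = begin
  length (mixed i L [ b ] ++ flat (shuffle i B s))
    ≡⟨ length-++ (mixed i L [ b ]) ⟩
  length (mixed i L [ b ]) + length (flat (shuffle i B s))
    ≡⟨ cong₂ _+_ (length-mixed i L [ b ]) (length-shuffle i B s (cong pred eq)) ⟩
  suc (length L) + (length B + length (flat s))
    ≡⟨ lemma (length L) (length B) (length (flat s)) ⟩
  suc (length B) + (length L + length (flat s))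
    ≡⟨ cong (suc (length B) +_) (length-++ L) ⟨
  suc (length B) + length (L ++ flat s) ∎
  where
  open ≡-Reasoning
  lemma : ∀ x y z → suc x + (y + z) ≡ suc y + (x + z)
  lemma = solve-∀

shuffle-LiveSize : ∀ {m} (i : I) (B : List A) (s : Seq S) → length B ≡ #live s →
                   All (LiveSize m) s → All (LiveSize (suc m)) (shuffle i B s)
shuffle-LiveSize i B [] eq [] = []
shuffle-LiveSize i B (dead L ∷ s) eq (_ ∷ h) = tt ∷ shuffle-LiveSize i B s eq h
shuffle-LiveSize i (b ∷ B) (live L ∷ s) eq (h₀ ∷ h) =
  trans (length-mixed i L [ b ]) (cong suc h₀) ∷ shuffle-LiveSize i B s (cong pred eq) h

#live-compose : ∀ (w : Seq A) (ι : Fin (#live w) → I) (s : Seq S) → #live (compose w ι s) ≡ #live w * #live s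
#live-compose [] ι s = refl
#live-compose (dead L ∷ w) ι s = #live-compose w ι s
#live-compose (live B ∷ w) ι s =
  trans (#live-++ (shuffle (ι zero) B s) _) (cong₂ _+_ (#live-shuffle (ι zero) B s) (#live-compose w (ι ∘ suc) s))

#dead-compose : ∀ (w : Seq A) (ι : Fin (#live w) → I) (s : Seq S) →
                #dead (compose w ι s) ≡ #dead w + #live w * suc (#dead s)
#dead-compose [] ι s = refl
#dead-compose (dead L ∷ w) ι s = cong suc (#dead-compose w ι s)
#dead-compose (live B ∷ w) ι s = begin
  #dead (shuffle (ι zero) B s ++ _ ∷ compose w (ι ∘ suc) s)
    ≡⟨ #dead-++ (shuffle (ι zero) B s) _ ⟩
  #dead (shuffle (ι zero) B s) + suc (#dead (compose w (ι ∘ suc) s))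
    ≡⟨ cong₂ (λ x y → x + suc y) (#dead-shuffle (ι zero) B s) (#dead-compose w (ι ∘ suc) s) ⟩
  #dead s + suc (#dead w + #live w * suc (#dead s))
    ≡⟨ lemma (#dead s) (#dead w) (#live w) ⟩
  #dead w + suc (#live w) * suc (#dead s) ∎
  where
  open ≡-Reasoning
  lemma : ∀ x y z → x + suc (y + z * suc x) ≡ y + suc z * suc x
  lemma = solve-∀

length-compose : ∀ (w : Seq A) (ι : Fin (#live w) → I) (s : Seq S) → All (LiveSize (#live s)) w →
                 length (flat (compose w ι s)) ≡ length (flat w) + #live w * (#live s + length (flat s))
length-compose [] ι s [] = refl
length-compose (dead L ∷ w) ι s (_ ∷ h) = begin
  length (map inj₁ L ++ flat (compose w ι s))
    ≡⟨ length-++ (map inj₁ L) ⟩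
  length (map inj₁ L) + length (flat (compose w ι s))
    ≡⟨ cong₂ _+_ (length-map inj₁ L) (length-compose w ι s h) ⟩
  length L + (length (flat w) + _)
    ≡⟨ +-assoc (length L) _ _ ⟨
  length L + length (flat w) + _
    ≡⟨ cong (_+ _) (length-++ L) ⟨
  length (L ++ flat w) + _ ∎
  where open ≡-Reasoning
length-compose (live B ∷ w) ι s (h₀ ∷ h) = begin
  length (flat (compose (live B ∷ w) ι s))
    ≡⟨ cong length (compose-live B w ι s) ⟩
  length (flat (shuffle (ι zero) B s) ++ map inj₁ (reverse B) ++ flat (compose w (ι ∘ suc) s))
    ≡⟨ length-++ (flat (shuffle (ι zero) B s)) ⟩
  length (flat (shuffle (ι zero) B s)) + length (map inj₁ (reverse B) ++ flat (compose w (ι ∘ suc) s))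
    ≡⟨ cong₂ _+_ (trans (length-shuffle (ι zero) B s h₀) (cong (_+ _) h₀)) (length-++ (map inj₁ (reverse B))) ⟩
  #live s + length (flat s) + (length (map inj₁ (reverse B)) + length (flat (compose w (ι ∘ suc) s)))
    ≡⟨ cong₂ (λ x y → #live s + length (flat s) + (x + y)) (trans (length-map inj₁ (reverse B)) (length-reverse B))
         (length-compose w (ι ∘ suc) s h) ⟩
  #live s + length (flat s) + (length B + (length (flat w) + #live w * (#live s + length (flat s))))
    ≡⟨ lemma (#live s + length (flat s)) (length B) (length (flat w)) (#live w) ⟩
  length B + length (flat w) + suc (#live w) * (#live s + length (flat s))
    ≡⟨ cong (_+ _) (length-++ B) ⟨
  length (B ++ flat w) + suc (#live w) * (#live s + length (flat s)) ∎
  where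
  open ≡-Reasoning
  lemma : ∀ x y z t → x + (y + (z + t * x)) ≡ y + z + suc t * x
  lemma = solve-∀

compose-LiveSize : ∀ {m} (w : Seq A) (ι : Fin (#live w) → I) (s : Seq S) → All (LiveSize (#live s)) w →
                   All (LiveSize m) s → All (LiveSize (suc m)) (compose w ι s)
compose-LiveSize [] ι s [] h = []
compose-LiveSize (dead L ∷ w) ι s (_ ∷ h₁) h = tt ∷ compose-LiveSize w ι s h₁ h
compose-LiveSize (live B ∷ w) ι s (h₀ ∷ h₁) h =
  All.++⁺ (shuffle-LiveSize (ι zero) B s h₀ h) (tt ∷ compose-LiveSize w (ι ∘ suc) s h₁ h)

-- The alphabet is a field because every composition changes it; `code` later turns letters into
-- vertices. The value `m * f` of `size` reflects that each letter has one live block.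
record Arrangement (m f d e : ℕ) : Set₁ where
  field
    Letter  : Set
    seq     : Seq Letter
    wf      : WF seq
    free    : Free seq
    size    : ℕ
    code    : Letter → Fin size
    code-injective : Injective _≡_ _≡_ code
    liveSize : All (LiveSize m) seq
    #letters : size ≡ m * f
    #lives   : #live seq ≡ f
    #deads   : #dead seq ≡ d
    #occurrences : length (flat seq) ≡ e

-- The outer block size and the inner number of live blocks are both `f`, so each live block of a
-- copy gains exactly one letter. Each of the `g` copies brings its own `d′` dead blocks and the
-- reversed block, which accounts for `f` further occurrences.
composite : ∀ {m f g d d′ e e′} → Arrangement f g d e → Arrangement m f d′ e′ →
            Arrangement (suc m) (g * f) (d + g * suc d′) (e + g * (f + e′))
composite {m}
  record { Letter = A ; seq = w ; wf = wf-w ; free = free-w ; size = n ; code = code-w ; code-injective = inj-w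
         ; liveSize = ls-w ; #letters = refl ; #lives = refl ; #deads = refl ; #occurrences = refl }
  record { Letter = S ; seq = s ; wf = wf-s ; free = free-s ; size = n′ ; code = code-s ; code-injective = inj-s
         ; liveSize = ls-s ; #letters = refl ; #lives = refl ; #deads = refl ; #occurrences = refl }
  = record
  { Letter = A ⊎ (Fin (#live w) × S)
  ; seq = compose w id s
  ; wf = compose-WF w id id wf-w wf-s
  ; free = compose-Free w id s id wf-w free-w free-s
  ; size = n + #live w * n′
  ; code = join n _ ∘ code
  ; code-injective = λ {x} {y} eq → code-inj x y
      (trans (sym (Fin.splitAt-join n _ (code x))) (trans (cong (splitAt n) eq) (Fin.splitAt-join n _ (code y))))
  ; liveSize = compose-LiveSize w id s ls-w ls-s
  ; #letters = lemma (#live s) (#live w) m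
  ; #lives = #live-compose w id s
  ; #deads = #dead-compose w id s
  ; #occurrences = length-compose w id s ls-w
  }
  where
  code : A ⊎ (Fin (#live w) × S) → Fin n ⊎ Fin (#live w * n′)
  code = Sum.map code-w (λ (i , x) → combine i (code-s x))
  code-inj : ∀ x y → code x ≡ code y → x ≡ y
  code-inj (inj₁ a) (inj₁ b) eq = cong inj₁ (inj-w (inj₁-injective eq))
  code-inj (inj₂ (i , x)) (inj₂ (j , y)) eq
    with refl , eq′ ← Fin.combine-injective i (code-s x) j (code-s y) (inj₂-injective eq) = cong (tag i) (inj-s eq′)
  lemma : ∀ f g m → f * g + g * (m * f) ≡ suc m * (g * f)
  lemma = solve-∀

-- Initial arrangements: disjoint live blocks

NoRepeat⇒WF : (w : Seq A) → NoRepeat (flat w) → WF w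
NoRepeat⇒WF [] nr = []
NoRepeat⇒WF (B ∷ w) nr =
  cons (λ e → nr (++⁺ʳ (flat w) e)) (λ h h′ → twice h (⊆-lookup (lives⊆flat w) h′))
       (λ e e′ → twice (live⇒letter B (⊆-lookup e (there (here refl)))) (⊆-lookup e′ (here refl)))
       (NoRepeat⇒WF w (λ e → nr (++⁺ˡ (letters B) e)))
  where
  twice : ∀ {a} → a ∈ letters B → a ∉ flat w
  twice h h′ = nr (++⁺ (from∈ h) (from∈ h′))
  live⇒letter : ∀ B {a} → a ∈ liveLetters B → a ∈ letters B
  live⇒letter (live _) h = h

NoRepeat⇒Free : (w : Seq A) → NoRepeat (flat w) → Free w
NoRepeat⇒Free w nr _ e = nr (⊆-trans (refl ∷ _ ∷ʳ refl ∷ _ ∷ʳ _ ∷ʳ []) e)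

fans : List I → List S → Seq (I × S)
fans is xs = map (λ i → live (map (i ,_) xs)) is

flat-fans : ∀ (is : List I) (xs : List S) → flat (fans is xs) ≡ cartesianProduct is xs
flat-fans [] xs = refl
flat-fans (i ∷ is) xs = cong (map (i ,_) xs ++_) (flat-fans is xs)

#live-fans : ∀ (is : List I) (xs : List S) → #live (fans is xs) ≡ length is
#live-fans [] xs = refl
#live-fans (i ∷ is) xs = cong suc (#live-fans is xs)

#dead-fans : ∀ (is : List I) (xs : List S) → #dead (fans is xs) ≡ 0
#dead-fans [] xs = refl
#dead-fans (i ∷ is) xs = #dead-fans is xs

length-fans : ∀ (is : List I) (xs : List S) → length (flat (fans is xs)) ≡ length is * length xs
length-fans [] xs = refl
length-fans (i ∷ is) xs =
  trans (length-++ (map (i ,_) xs)) (cong₂ _+_ (length-map (i ,_) xs) (length-fans is xs))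

base : ∀ p m → Arrangement m p 0 (p * m)
base p m = record
  { Letter = Fin p × Fin m
  ; seq = fans (allFin p) (allFin m)
  ; wf = NoRepeat⇒WF (fans (allFin p) (allFin m)) nr
  ; free = NoRepeat⇒Free (fans (allFin p) (allFin m)) nr
  ; size = p * m
  ; code = uncurry combine
  ; code-injective = λ { {i , x} {j , y} eq → uncurry (cong₂ _,_) (Fin.combine-injective i x j y eq) }
  ; liveSize = All.map⁺ (All.universal (λ i → trans (length-map (i ,_) (allFin m)) (length-tabulate id)) (allFin p))
  ; #letters = *-comm p m
  ; #lives = trans (#live-fans (allFin p) (allFin m)) (length-tabulate id)
  ; #deads = #dead-fans (allFin p) (allFin m)
  ; #occurrences = trans (length-fans (allFin p) (allFin m))
      (cong₂ _*_ (length-tabulate {n = p} id) (length-tabulate {n = m} id))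
  }
  where
  nr : NoRepeat (flat (fans (allFin p) (allFin m)))
  nr = Unique⇒NoRepeat (subst Unique (sym (flat-fans (allFin p) (allFin m)))
         (Unique.cartesianProduct⁺ (Unique.allFin⁺ p) (Unique.allFin⁺ m)))

-- From arrangements to graphs

incidences : (w : Seq A) → List (A × Fin (length w))
incidences [] = []
incidences (B ∷ w) = map (_, zero) (letters B) ++ map (map₂ suc) (incidences w)

incidences-letters : (w : Seq A) → map proj₁ (incidences w) ≡ flat w
incidences-letters [] = refl
incidences-letters (B ∷ w) = begin
  map proj₁ (map (_, zero) (letters B) ++ map (map₂ suc) (incidences w))
    ≡⟨ map-++ proj₁ (map (_, zero) (letters B)) _ ⟩
  map proj₁ (map (_, zero) (letters B)) ++ map proj₁ (map (map₂ suc) (incidences w))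
    ≡⟨ cong₂ _++_ (trans (sym (map-∘ (letters B))) (map-id (letters B))) (sym (map-∘ (incidences w))) ⟩
  letters B ++ map proj₁ (incidences w)
    ≡⟨ cong (letters B ++_) (incidences-letters w) ⟩
  letters B ++ flat w ∎
  where open ≡-Reasoning

incidences-sorted : (w : Seq A) → AllPairs (λ x y → proj₂ x Fin.≤ proj₂ y) (incidences w)
incidences-sorted [] = []
incidences-sorted (B ∷ w) = prepend (letters B) (AllPairs.map⁺ (AllPairs.map s≤s (incidences-sorted w)))
  where
  prepend : ∀ L {ys : List (_ × Fin (suc (length w)))} → AllPairs (λ x y → proj₂ x Fin.≤ proj₂ y) ys →
            AllPairs (λ x y → proj₂ x Fin.≤ proj₂ y) (map (_, zero) L ++ ys)
  prepend [] h = h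
  prepend (_ ∷ L) h = All.universal (λ _ → z≤n) _ ∷ prepend L h

incidences-unique : {w : Seq A} → WF w → Unique (incidences w)
incidences-unique [] = []
incidences-unique {w = B ∷ w} (cons nr _ _ wf) = Unique.++⁺
  (Unique.map⁺ ,-injectiveˡ (NoRepeat⇒Unique nr))
  (Unique.map⁺ (λ { {_ , _} {_ , _} refl → refl }) (incidences-unique wf))
  λ { (h , h′) → apart (∈-map⁻ (_, zero) h) (∈-map⁻ (map₂ suc) h′) }
  where
  apart : ∀ {z} → ∃ (λ a → a ∈ letters B × z ≡ (a , zero)) → ¬ ∃ λ y → y ∈ incidences w × z ≡ map₂ suc y
  apart (_ , _ , refl) (_ , _ , ())

AllPairs-⊆ : {R : A → A → Set} {x y : A} → AllPairs R u → x ∷ y ∷ [] ⊆ u → R x y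
AllPairs-⊆ (_ ∷ h) (_ ∷ʳ e) = AllPairs-⊆ h e
AllPairs-⊆ (h₀ ∷ _) (refl ∷ e) = All.lookup h₀ (to∈ e)

⊆-map⁻ : (f : A → S) → ∀ u → q ⊆ map f u → ∃ λ p → p ⊆ u × q ≡ map f p
⊆-map⁻ f [] [] = [] , [] , refl
⊆-map⁻ f (x ∷ u) (_ ∷ʳ e) with p , e′ , eq ← ⊆-map⁻ f u e = p , x ∷ʳ e′ , eq
⊆-map⁻ f (x ∷ u) (refl ∷ e) with p , e′ , eq ← ⊆-map⁻ f u e = x ∷ p , refl ∷ e′ , cong (f x ∷_) eq

lookup-∷-⊆ : ∀ (xs : List A) (i : Fin (length xs)) {k} → toℕ i < k → q ⊆ drop k xs → lookup xs i ∷ q ⊆ drop (toℕ i) xs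
lookup-∷-⊆ xs i i<k e = ⊆-trans (refl ∷ ⊆-trans e (drop⁺-≥ i<k)) (⊆-reflexive (unfold xs i))
  where
  unfold : ∀ xs i → lookup xs i ∷ drop (suc (toℕ i)) xs ≡ drop (toℕ i) xs
  unfold (x ∷ xs) zero = refl
  unfold (x ∷ xs) (suc i) = unfold xs i

-- Turns the position map of `Contains` into a sublist. The `drop` records where the sublist starts,
-- which the induction needs in order to prepend an earlier entry.
increasing-⊆ : ∀ (xs : List A) {k} (σ : Fin (suc k) → Fin (length xs)) → (∀ i j → i Fin.< j → σ i Fin.< σ j) →
               tabulate (lookup xs ∘ σ) ⊆ drop (toℕ (σ zero)) xs
increasing-⊆ xs {zero} σ mono = lookup-∷-⊆ xs (σ zero) ≤-refl (minimum _)
increasing-⊆ xs {suc k} σ mono = lookup-∷-⊆ xs (σ zero) (mono zero (suc zero) (s≤s z≤n))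
  (increasing-⊆ xs (σ ∘ suc) (λ i j i<j → mono (suc i) (suc j) (s≤s i<j)))

module _ {m f d e n : ℕ} (Z : Arrangement m f d e) (fits : m * f + (f + d) ≤ n) where
  open Arrangement Z

  fits′ : size + length seq ≤ n
  fits′ = subst (_≤ n) (sym (cong₂ _+_ #letters (trans (length-blocks seq) (cong₂ _+_ #lives #deads)))) fits

  letterVertex : Letter → Fin n
  letterVertex a = inject≤ (code a ↑ˡ length seq) fits′

  -- Blocks are numbered after all letters, so every edge runs from a letter up to a block; vertices
  -- beyond both ranges stay isolated.
  blockVertex : Fin (length seq) → Fin n
  blockVertex j = inject≤ (size ↑ʳ j) fits′

  letterVertex-injective : Injective _≡_ _≡_ letterVertex
  letterVertex-injective eq = code-injective (Fin.↑ˡ-injective _ _ _ (Fin.inject≤-injective fits′ fits′ _ _ eq))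

  blockVertex-injective : Injective _≡_ _≡_ blockVertex
  blockVertex-injective eq = Fin.↑ʳ-injective size _ _ (Fin.inject≤-injective fits′ fits′ _ _ eq)

  letter<block : ∀ a j → letterVertex a Fin.< blockVertex j
  letter<block a j = begin-strict
    toℕ (letterVertex a)        ≡⟨ Fin.toℕ-inject≤ _ fits′ ⟩
    toℕ (code a ↑ˡ length seq)  ≡⟨ Fin.toℕ-↑ˡ (code a) _ ⟩
    toℕ (code a)                <⟨ Fin.toℕ<n (code a) ⟩
    size                        ≤⟨ m≤m+n size (toℕ j) ⟩
    size + toℕ j                ≡⟨ Fin.toℕ-↑ʳ size j ⟨
    toℕ (size ↑ʳ j)             ≡⟨ Fin.toℕ-inject≤ _ fits′ ⟨
    toℕ (blockVertex j)         ∎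
    where open ≤-Reasoning

  letter≢block : ∀ {a j} → letterVertex a ≢ blockVertex j
  letter≢block {a} {j} eq = <⇒≢ (letter<block a j) (cong toℕ eq)

  edge : Letter × Fin (length seq) → Fin n × Fin n
  edge (a , j) = letterVertex a , blockVertex j

  graph : EOGraph n
  graph = record
    { edges  = map edge (incidences seq)
    ; normal = All.map⁺ (All.universal (λ (a , j) → letter<block a j) _)
    ; simple = Unique.map⁺ (λ { {a , i} {b , j} eq →
                 cong₂ _,_ (letterVertex-injective (,-injectiveˡ eq)) (blockVertex-injective (,-injectiveʳ eq)) })
                 (incidences-unique wf)
    }

  graph-size : length (edges graph) ≡ e
  graph-size = begin
    length (map edge (incidences seq))   ≡⟨ length-map edge (incidences seq) ⟩
    length (incidences seq)              ≡⟨ length-map proj₁ (incidences seq) ⟨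
    length (map proj₁ (incidences seq))  ≡⟨ cong length (incidences-letters seq) ⟩
    length (flat seq)                    ≡⟨ #occurrences ⟩
    e                                    ∎
    where open ≡-Reasoning

  -- Block indices never decrease along the edge order.
  squeeze : ∀ {x y z} → x ∷ y ∷ z ∷ [] ⊆ incidences seq → proj₂ x ≡ proj₂ z → proj₂ y ≡ proj₂ x
  squeeze e refl = Fin.≤-antisym (AllPairs-⊆ sorted (∷ˡ⁻ e)) (AllPairs-⊆ sorted (⊆-trans (refl ∷ refl ∷ _ ∷ʳ []) e))
    where sorted = incidences-sorted seq

  star-forest-free : ∀ (φ : Fin 7 → Fin n) → Injective _≡_ _≡_ φ → ∀ {x₁ x₂ x₃ x₄ x₅} →
    x₁ ∷ x₂ ∷ x₃ ∷ x₄ ∷ x₅ ∷ [] ⊆ incidences seq →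
    Joins (edge x₁) (φ (v 0)) (φ (v 1)) → Joins (edge x₂) (φ (v 4)) (φ (v 5)) → Joins (edge x₃) (φ (v 0)) (φ (v 2)) →
    Joins (edge x₄) (φ (v 4)) (φ (v 6)) → ¬ Joins (edge x₅) (φ (v 0)) (φ (v 3))
  star-forest-free φ inj {x₁} {x₂} {x₃} {x₄} {x₅} e J₁ J₂ J₃ J₄ J₅ = go J₁ J₂ J₃ J₄ J₅
    where
    same-letter : ∀ {x y X Y Z} → edge x ≡ (X , Y) → edge y ≡ (X , Z) → proj₁ x ≡ proj₁ y
    same-letter eq eq′ = letterVertex-injective (trans (,-injectiveˡ eq) (sym (,-injectiveˡ eq′)))
    same-block : ∀ {x y X Y Z} → edge x ≡ (Y , X) → edge y ≡ (Z , X) → proj₂ x ≡ proj₂ y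
    same-block eq eq′ = blockVertex-injective (trans (,-injectiveʳ eq) (sym (,-injectiveʳ eq′)))
    clash : ∀ {x y X Y Z} → edge x ≡ (X , Y) → edge y ≢ (Z , X)
    clash eq eq′ = letter≢block (trans (,-injectiveˡ eq) (sym (,-injectiveʳ eq′)))
    blocks-meet : ∀ {x y X Y Z W} → proj₂ x ≡ proj₂ y → edge x ≡ (X , Y) → edge y ≡ (Z , W) → Y ≡ W
    blocks-meet j eq eq′ = trans (sym (,-injectiveʳ eq)) (trans (cong blockVertex j) (,-injectiveʳ eq′))
    e₁₂₃ : x₁ ∷ x₂ ∷ x₃ ∷ [] ⊆ incidences seq
    e₁₂₃ = ⊆-trans (refl ∷ refl ∷ refl ∷ _ ∷ʳ _ ∷ʳ []) e
    e₂₃₄ : x₂ ∷ x₃ ∷ x₄ ∷ [] ⊆ incidences seq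
    e₂₃₄ = ⊆-trans (_ ∷ʳ refl ∷ refl ∷ refl ∷ _ ∷ʳ []) e
    e-letters : proj₁ x₁ ∷ proj₁ x₂ ∷ proj₁ x₃ ∷ proj₁ x₄ ∷ proj₁ x₅ ∷ [] ⊆ flat seq
    e-letters = subst (_ ⊆_) (incidences-letters seq) (⊆-map⁺ proj₁ e)
    alternation : ∀ {a b c d e} → a ≡ c → a ≡ e → b ≡ d → a ≢ b → ¬ (a ∷ b ∷ c ∷ d ∷ e ∷ [] ⊆ flat seq)
    alternation refl refl refl = free
    go : Joins (edge x₁) (φ (v 0)) (φ (v 1)) → Joins (edge x₂) (φ (v 4)) (φ (v 5)) → Joins (edge x₃) (φ (v 0)) (φ (v 2)) →
         Joins (edge x₄) (φ (v 4)) (φ (v 6)) → ¬ Joins (edge x₅) (φ (v 0)) (φ (v 3))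
    -- The first five clauses use that no vertex is both a letter and a block, so the edges of one
    -- star are all oriented alike.
    go (inj₁ p₁) J₂ (inj₂ p₃) J₄ J₅ = clash p₁ p₃
    go (inj₂ p₁) J₂ (inj₁ p₃) J₄ J₅ = clash p₃ p₁
    go (inj₁ p₁) J₂ J₃ J₄ (inj₂ p₅) = clash p₁ p₅
    go J₁ (inj₁ p₂) J₃ (inj₂ p₄) J₅ = clash p₂ p₄
    go J₁ (inj₂ p₂) J₃ (inj₁ p₄) J₅ = clash p₄ p₂
    go (inj₁ p₁) (inj₁ p₂) (inj₁ p₃) (inj₁ p₄) (inj₁ p₅) =
      alternation (same-letter p₁ p₃) (same-letter p₁ p₅) (same-letter p₂ p₄)
        (λ eq → v≢ (inj (trans (sym (,-injectiveˡ p₁)) (trans (cong letterVertex eq) (,-injectiveˡ p₂))))) e-letters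
      where
      v≢ : v 0 ≢ v 4
      v≢ ()
    -- The smaller star is centred at a block. The third edge lies between its two edges and so
    -- meets that block, identifying a leaf with the other centre.
    go (inj₁ p₁) (inj₂ p₂) (inj₁ p₃) (inj₂ p₄) (inj₁ p₅) =
      v≢ (inj (blocks-meet (squeeze e₂₃₄ (same-block p₂ p₄)) p₃ p₂))
      where
      v≢ : v 2 ≢ v 4
      v≢ ()
    -- The larger star is centred at a block, which the second edge, lying between the first and the
    -- third, has to meet as well; here its block end is a leaf, in the next clause its centre.
    go (inj₂ p₁) (inj₁ p₂) (inj₂ p₃) J₄ J₅ = v≢ (inj (blocks-meet (squeeze e₁₂₃ (same-block p₁ p₃)) p₂ p₁))
      where
      v≢ : v 5 ≢ v 0
      v≢ ()
    go (inj₂ p₁) (inj₂ p₂) (inj₂ p₃) J₄ J₅ = v≢ (inj (blocks-meet (squeeze e₁₂₃ (same-block p₁ p₃)) p₂ p₁))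
      where
      v≢ : v 4 ≢ v 0
      v≢ ()

  graph-free : ¬ Contains F graph
  graph-free (φ , inj , σ , mono , joins)
    with ⊆-map⁻ edge (incidences seq) (⊆-trans (increasing-⊆ (edges graph) σ mono) (drop-⊆ (toℕ (σ zero)) (edges graph)))
  ... | x₁ ∷ x₂ ∷ x₃ ∷ x₄ ∷ x₅ ∷ [] , e , eq
    with eq₁ , eq′ ← ∷-injective eq
    with eq₂ , eq′ ← ∷-injective eq′
    with eq₃ , eq′ ← ∷-injective eq′
    with eq₄ , eq′ ← ∷-injective eq′
    with eq₅ , _ ← ∷-injective eq′ =
    star-forest-free φ inj e (on eq₁ (joins (# 0))) (on eq₂ (joins (# 1))) (on eq₃ (joins (# 2)))
      (on eq₄ (joins (# 3))) (on eq₅ (joins (# 4)))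
    where
    on : ∀ {x y X Y} → x ≡ y → Joins x X Y → Joins y X Y
    on refl J = J

-- Ackermann growth

-- The parameters produced by `composite`, nested as in the third clause of `ack`: the inner
-- arrangement is at the same level with smaller blocks, the outer one a level lower with block size
-- `liveCount (suc k) m`. Starting from two live blocks provides the slack used in
-- `deadCount<liveCount`.
liveCount deadCount occurrenceCount : ℕ → ℕ → ℕ
liveCount zero m = 2
liveCount (suc k) zero = 2
liveCount (suc k) (suc m) = liveCount k (liveCount (suc k) m) * liveCount (suc k) m
deadCount zero m = 0
deadCount (suc k) zero = 0
deadCount (suc k) (suc m) =
  deadCount k (liveCount (suc k) m) + liveCount k (liveCount (suc k) m) * suc (deadCount (suc k) m)
occurrenceCount zero m = 2 * m
occurrenceCount (suc k) zero = 0
occurrenceCount (suc k) (suc m) =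
  occurrenceCount k (liveCount (suc k) m) + liveCount k (liveCount (suc k) m) * (liveCount (suc k) m + occurrenceCount (suc k) m)

ackermannian : ∀ k m → Arrangement m (liveCount k m) (deadCount k m) (occurrenceCount k m)
ackermannian zero m = base 2 m
ackermannian (suc k) zero = base 2 0
ackermannian (suc k) (suc m) = composite (ackermannian k (liveCount (suc k) m)) (ackermannian (suc k) m)

-- In the induction step the outer dead blocks and the newly added ones number at most g each; the
-- slack of 2 in the inner sequence, available g times, absorbs them.
deadCount<liveCount : ∀ k m → 2 + deadCount k m ≤ liveCount k m
deadCount<liveCount zero m = ≤-refl
deadCount<liveCount (suc k) zero = ≤-refl
deadCount<liveCount (suc k) (suc m) = begin
  2 + (deadCount k f + g * suc d)  ≡⟨ +-assoc 2 (deadCount k f) (g * suc d) ⟨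
  2 + deadCount k f + g * suc d    ≤⟨ +-monoˡ-≤ (g * suc d) (deadCount<liveCount k f) ⟩
  g + g * suc d                    ≡⟨ *-suc g (suc d) ⟨
  g * (2 + d)                      ≤⟨ *-monoʳ-≤ g (deadCount<liveCount (suc k) m) ⟩
  g * f                            ∎
  where
  open ≤-Reasoning
  f = liveCount (suc k) m
  g = liveCount k f
  d = deadCount (suc k) m

-- There are `m * liveCount k m` letters, each occurring `suc k` times: composing adds one
-- occurrence to the outer letters, which come from one level below, and so brings them level with
-- the inner ones.
occurrenceCount≡ : ∀ k m → occurrenceCount k m ≡ suc k * (m * liveCount k m)
occurrenceCount≡ zero m = lemma m
  where
  lemma : ∀ m → 2 * m ≡ 1 * (m * 2)
  lemma = solve-∀
occurrenceCount≡ (suc k) zero = sym (*-zeroʳ (2 + k))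
occurrenceCount≡ (suc k) (suc m) = begin
  occurrenceCount k f + g * (f + occurrenceCount (suc k) m)
    ≡⟨ cong₂ (λ x y → x + g * (f + y)) (occurrenceCount≡ k f) (occurrenceCount≡ (suc k) m) ⟩
  suc k * (f * g) + g * (f + suc (suc k) * (m * f))
    ≡⟨ lemma k m f g ⟩
  suc (suc k) * (suc m * (g * f)) ∎
  where
  open ≡-Reasoning
  f = liveCount (suc k) m
  g = liveCount k f
  lemma : ∀ k m f g → suc k * (f * g) + g * (f + suc (suc k) * (m * f)) ≡ suc (suc k) * (suc m * (g * f))
  lemma = solve-∀

-- Estimates for `ack`

n<ack : ∀ k n → n < ack k n
n<ack zero n = ≤-refl
n<ack (suc k) zero = ≤-trans (s≤s z≤n) (n<ack k 1)
n<ack (suc k) (suc n) = ≤-trans (s≤s (n<ack (suc k) n)) (n<ack k (ack (suc k) n))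

ack-suc : ∀ k n → ack k n ≤ ack k (suc n)
ack-suc zero n = n≤1+n (suc n)
ack-suc (suc k) n = <⇒≤ (n<ack k (ack (suc k) n))

ack-monoʳ : ∀ k {m n} → m ≤ n → ack k m ≤ ack k n
ack-monoʳ k m≤n = go (≤⇒≤′ m≤n)
  where
  go : ∀ {m n} → m ≤′ n → ack k m ≤ ack k n
  go ≤′-refl = ≤-refl
  go (≤′-step h) = ≤-trans (go h) (ack-suc k _)

ack-level : ∀ k n → ack k n ≤ ack (suc k) n
ack-level k zero = ack-suc k 0
ack-level k (suc n) = ack-monoʳ k (n<ack (suc k) n)

ack-monoˡ : ∀ {j k} n → j ≤ k → ack j n ≤ ack k n
ack-monoˡ n j≤k = go (≤⇒≤′ j≤k)
  where
  go : ∀ {j k} → j ≤′ k → ack j n ≤ ack k n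
  go ≤′-refl = ≤-refl
  go (≤′-step h) = ≤-trans (go h) (ack-level _ n)

ack1 : ∀ n → ack 1 n ≡ 2 + n
ack1 zero = refl
ack1 (suc n) = cong suc (ack1 n)

ack2 : ∀ n → ack 2 n ≡ 3 + 2 * n
ack2 zero = refl
ack2 (suc n) = begin
  ack 1 (ack 2 n)  ≡⟨ ack1 (ack 2 n) ⟩
  2 + ack 2 n      ≡⟨ cong (2 +_) (ack2 n) ⟩
  5 + 2 * n        ≡⟨ cong (3 +_) (*-suc 2 n) ⟨
  3 + 2 * suc n    ∎
  where open ≡-Reasoning

-- From level 3 on, a unit step in the argument applies a function at least as large as `ack 2`.
ack-doubles : ∀ k n → 3 + 2 * ack (3 + k) n ≤ ack (3 + k) (suc n)
ack-doubles k n = ≤-trans (≤-reflexive (sym (ack2 z))) (ack-monoˡ z (m≤m+n 2 k))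
  where z = ack (3 + k) n

5≤ack : ∀ k n → 5 ≤ ack (3 + k) n
5≤ack k n = ≤-trans (ack-monoˡ {3} 0 (m≤m+n 3 k)) (ack-monoʳ (3 + k) {0} {n} z≤n)

3*n≤ack : ∀ k n → 3 * n ≤ ack (3 + k) n
3*n≤ack k zero = z≤n
3*n≤ack k (suc n) = begin
  3 * suc n              ≡⟨ *-suc 3 n ⟩
  3 + 3 * n              ≤⟨ +-monoʳ-≤ 3 (3*n≤ack k n) ⟩
  3 + ack (3 + k) n      ≤⟨ +-monoʳ-≤ 3 (m≤m+n _ _) ⟩
  3 + 2 * ack (3 + k) n  ≤⟨ ack-doubles k n ⟩
  ack (3 + k) (suc n)    ∎
  where open ≤-Reasoning

-- Each unit added to the argument at least doubles the value, and the `x`-th power of 2 is at least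
-- `suc x`.
ack-absorbs : ∀ k x n → ack (3 + k) n * suc x ≤ ack (3 + k) (x + n)
ack-absorbs k zero n = ≤-reflexive (*-identityʳ _)
ack-absorbs k (suc x) n = begin
  lo * suc (suc x)           ≤⟨ *-monoʳ-≤ lo (s≤s (m≤n+m (suc x) x)) ⟩
  lo * (suc x + suc x)       ≡⟨ *-distribˡ-+ lo (suc x) (suc x) ⟩
  lo * suc x + lo * suc x    ≤⟨ +-mono-≤ (ack-absorbs k x n) (ack-absorbs k x n) ⟩
  hi + hi                    ≡⟨ cong (hi +_) (+-identityʳ hi) ⟨
  2 * hi                     ≤⟨ m≤n+m (2 * hi) 3 ⟩
  3 + 2 * hi                 ≤⟨ ack-doubles k (x + n) ⟩
  ack (3 + k) (suc (x + n))  ∎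
  where
  open ≤-Reasoning
  lo = ack (3 + k) n
  hi = ack (3 + k) (x + n)

-- The offset 3 makes `ack-doubles` available, so the factor `f` is absorbed into the argument. The
-- coefficient 2 allows two applications of `ack (3 + k)` per step: one bounds the recursive count,
-- the other covers the argument `3 * z`.
liveCount≤ack : ∀ k m → liveCount k m ≤ ack (3 + k) (2 * m)
liveCount≤ack zero m = ≤-trans (m≤n+m 2 3) (5≤ack 0 (2 * m))
liveCount≤ack (suc k) zero = ≤-trans (m≤n+m 2 3) (5≤ack (suc k) 0)
liveCount≤ack (suc k) (suc m) = begin
  liveCount k f * f            ≤⟨ *-mono-≤ (liveCount≤ack k f) (n≤1+n f) ⟩
  ack (3 + k) (2 * f) * suc f  ≤⟨ ack-absorbs k f (2 * f) ⟩
  ack (3 + k) (3 * f)          ≤⟨ ack-monoʳ (3 + k) (*-monoʳ-≤ 3 (liveCount≤ack (suc k) m)) ⟩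
  ack (3 + k) (3 * z)          ≤⟨ ack-monoʳ (3 + k) (3*n≤ack k z) ⟩
  ack (4 + k) (2 + 2 * m)      ≡⟨ cong (ack (4 + k)) (*-suc 2 m) ⟨
  ack (4 + k) (2 * suc m)      ∎
  where
  open ≤-Reasoning
  f = liveCount (suc k) m
  z = ack (4 + k) (2 * m)

4*liveCount≤ack : ∀ k → 4 * liveCount k 1 ≤ ack (3 + k) 4
4*liveCount≤ack k = begin
  4 * liveCount k 1        ≤⟨ *-monoʳ-≤ 4 (liveCount≤ack k 1) ⟩
  4 * ack (3 + k) 2        ≡⟨ *-assoc 2 2 (ack (3 + k) 2) ⟩
  2 * (2 * ack (3 + k) 2)  ≤⟨ *-monoʳ-≤ 2 (doubles 2) ⟩
  2 * ack (3 + k) 3        ≤⟨ doubles 3 ⟩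
  ack (3 + k) 4            ∎
  where
  open ≤-Reasoning
  doubles : ∀ n → 2 * ack (3 + k) n ≤ ack (3 + k) (suc n)
  doubles n = ≤-trans (m≤n+m _ 3) (ack-doubles k n)

-- The search function behind α is private; the placeholder is solved to it by unification in the
-- last clause of α-least, once its arguments are abstracted to variables.
mutual
  least : ℕ → ℕ → ℕ → ℕ
  least n k fuel = _

  α-least : ∀ n → ¬ suc n ≤ ack 0 0 → ¬ suc n ≤ ack 1 1 → α (suc n) ≡ least (suc n) 2 n
  α-least n ¬0 ¬1 with suc n ≤? ack 0 0
  ... | yes p = contradiction p ¬0
  ... | no _ with suc n ≤? ack 1 1
  ...   | yes p = contradiction p ¬1
  ...   | no _ with suc n | 2
  ...     | N | k = refl

-- The hypothesis says that the candidate just below `k` has failed. It is kept at every step, so it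
-- also covers a search that stops for want of fuel.
least-bound : ∀ n k f q → (∀ r → k ≡ suc r → ack r r < n) → least n k f ≡ suc q → ack q q < n
least-bound n k zero q h e = h q e
least-bound n k (suc f) q h e with n ≤? ack k k
... | yes _ = h q e
... | no n≰ = least-bound n (suc k) f q (λ { r refl → ≰⇒> n≰ }) e

α-bound : ∀ n q → 8 ≤ n → α n ≡ suc q → ack q q < n
α-bound (suc n) q 8≤n eq = least-bound (suc n) 2 n q (λ { _ refl → ≤-trans (s≤s (s≤s (s≤s (s≤s z≤n)))) 8≤n })
  (trans (sym (α-least n (λ h → <⇒≱ 8≤n (≤-trans h (s≤s z≤n))) (λ h → <⇒≱ 8≤n (≤-trans h (s≤s (s≤s (s≤s z≤n))))))) eq)

-- If `α n` is at most 5, truncated subtraction gives level 0, where the left side is 8. Otherwise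
-- the diagonal value that the search rejected last dominates the bound of `4*liveCount≤ack`.
4*liveCount≤n : ∀ n → 8 ≤ n → 4 * liveCount (α n ∸ 5) 1 ≤ n
4*liveCount≤n n 8≤n = go (α n) refl
  where
  go : ∀ q → α n ≡ q → 4 * liveCount (q ∸ 5) 1 ≤ n
  go 0 _ = 8≤n
  go 1 _ = 8≤n
  go 2 _ = 8≤n
  go 3 _ = 8≤n
  go 4 _ = 8≤n
  go 5 _ = 8≤n
  go (suc (suc (suc (suc (suc (suc k)))))) eq = begin
    4 * liveCount (suc k) 1  ≤⟨ 4*liveCount≤ack (suc k) ⟩
    ack (4 + k) 4            ≤⟨ ack-level (4 + k) 4 ⟩
    ack (5 + k) 4            ≤⟨ ack-monoʳ (5 + k) (m≤m+n 4 (suc k)) ⟩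
    ack (5 + k) (4 + suc k)  ≡⟨ cong (ack (5 + k)) (+-suc 4 k) ⟩
    ack (5 + k) (5 + k)      <⟨ α-bound n (5 + k) 8≤n eq ⟩
    n                        ∎
    where open ≤-Reasoning

4*liveCount-nonZero : ∀ k m → NonZero (4 * liveCount k m)
4*liveCount-nonZero k m = >-nonZero (≤-trans (≤-trans (s≤s z≤n) (deadCount<liveCount k m)) (m≤n*m (liveCount k m) 4))

-- Scaling to n vertices

n≤2*[n/d]*d : ∀ n d .{{_ : NonZero d}} → d ≤ n → n ≤ 2 * (n / d * d)
n≤2*[n/d]*d n d d≤n = begin
  n
    ≡⟨ m≡m%n+[m/n]*n n d ⟩
  n % d + n / d * d
    ≤⟨ +-monoˡ-≤ (n / d * d) (≤-trans (m%n≤n n d) (m≤n*m d (n / d) {{>-nonZero (m≥n⇒m/n>0 d≤n)}})) ⟩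
  n / d * d + n / d * d
    ≡⟨ cong (n / d * d +_) (+-identityʳ _) ⟨
  2 * (n / d * d) ∎
  where open ≤-Reasoning

theorem3p5 : Σ ℕ λ c → Σ ℕ λ N → (n : ℕ) → N ≤ n →
    Σ (EOGraph n) λ G → (n * α n ≤ suc c * length (edges G)) × ¬ Contains F G
-- The factor `suc 15` is the 16 of `many`; the threshold 8 is `4 * liveCount 0 1`, the size of the
-- smallest building block.
theorem3p5 = 15 , 8 , λ n 8≤n → construction n 8≤n
  where
  module _ (n : ℕ) (8≤n : 8 ≤ n) where
    k = α n ∸ 5
    f = liveCount k 1
    instance
      4f≢0 : NonZero (4 * f)
      4f≢0 = 4*liveCount-nonZero k 1
    -- composite (base c f) (ackermannian k 1) has at most 4 c f vertices.
    c = n / (4 * f)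

    fits : 2 * (c * f) + (c * f + c * suc (deadCount k 1)) ≤ n
    fits = begin
      2 * (c * f) + (c * f + c * suc (deadCount k 1))
        ≤⟨ +-monoʳ-≤ (2 * (c * f)) (+-monoʳ-≤ (c * f) (*-monoʳ-≤ c (≤-trans (n≤1+n _) (deadCount<liveCount k 1)))) ⟩
      2 * (c * f) + (c * f + c * f)
        ≡⟨ lemma c f ⟩
      c * (4 * f)
        ≤⟨ m/n*n≤m n (4 * f) ⟩
      n ∎
      where
      open ≤-Reasoning
      lemma : ∀ c f → 2 * (c * f) + (c * f + c * f) ≡ c * (4 * f)
      lemma = solve-∀

    -- The outer arrangement serves to take `c` copies of one Ackermann arrangement, filling a
    -- constant fraction of the `n` vertices.
    arrangement = composite (base c f) (ackermannian k 1)

    many : n * α n ≤ 16 * (c * f + c * (f + occurrenceCount k 1))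
    many = begin
      n * α n
        ≤⟨ *-mono-≤ (n≤2*[n/d]*d n (4 * f) (4*liveCount≤n n 8≤n)) (m≤n+m∸n (α n) 5) ⟩
      2 * (c * (4 * f)) * (5 + k)
        -- Rounding `5 + k` up to `2 * (3 + k)` matches the edge count, which is `c * f * (3 + k)`.
        ≤⟨ *-monoʳ-≤ (2 * (c * (4 * f))) (≤-trans (n≤1+n _) (m≤m+n (6 + k) k)) ⟩
      2 * (c * (4 * f)) * (6 + k + k)
        ≡⟨ lemma c f k ⟩
      16 * (c * f + c * (f + suc k * (1 * f)))
        ≡⟨ cong (λ x → 16 * (c * f + c * (f + x))) (occurrenceCount≡ k 1) ⟨
      16 * (c * f + c * (f + occurrenceCount k 1)) ∎
      where
      open ≤-Reasoning
      lemma : ∀ c f k → 2 * (c * (4 * f)) * (6 + k + k) ≡ 16 * (c * f + c * (f + suc k * (1 * f)))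
      lemma = solve-∀

    construction : Σ (EOGraph n) λ G → (n * α n ≤ 16 * length (edges G)) × ¬ Contains F G
    construction = graph arrangement fits ,
      subst (λ e → n * α n ≤ 16 * e) (sym (graph-size arrangement fits)) many ,
      graph-free arrangement fits
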